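{- Let $\mathcal{L}=\{S_1,\dots,S_k\}$ be a finite list of integer compositions (finite words over the alphabet of positive integers) such that no word on the list is contained as a subword (block of consecutive letters) in any other word of the list. Suppose further that all correlation polynomials $c_{ij}(x,q)=c_{S_iS_j}(x,q)$ with $i\neq j$ vanish identically. Let \[F(x,q)=\sum_{\sigma}x^{w(\sigma)}q^{\ell(\sigma)},\] the sum being extended over all compositions $\sigma$ of all nonnegative integers (including the empty composition) that avoid every word of $\mathcal{L}$ as a subword, where $\ell(\sigma)$ is the number of parts of $\sigma$ and $w(\sigma)$ is the sum of the parts of $\sigma$. Then, as formal power series, \[F(x,q)=\frac{1}{1-\frac{qx}{1-x}+\sum_{j=1}^{k}\frac{x^{w(S_j)}q^{\ell(S_j)}}{c_{jj}(x,q)}}.\]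
   Context: A composition is regarded as a word $a_1a_2\cdots a_m$ over the alphabet of positive integers; the weight of a letter $u$ is $w(u)=u$ and the weight $w$ of a word is the sum of the weights of its letters; the length $\ell$ is the number of letters. A word $\sigma$ contains $S$ as a subword if $S$ occurs as a block of consecutive letters of $\sigma$; $\sigma$ avoids $S$ otherwise. Correlation: for words $X=a_0a_1\cdots a_{m-1}$ (of length $m$) and $Y$, and $0\le j\le m-1$, put $c_j=1$ if $Y$ has length at least $m-j$ and the prefix $a_0\cdots a_{m-1-j}$ of $X$ equals the suffix of $Y$ of length $m-j$ (i.e. after aligning right ends and shifting $Y$ $j$ places to the left, the overlapping parts agree), and $c_j=0$ otherwise. The correlation polynomial of $X$ on $Y$ is \[c_{XY}(x,q)=c_0+c_1x^{w(a_{m-1})}q+c_2x^{w(a_{m-2}a_{m-1})}q^2+\dots+c_{m-1}x^{w(a_1a_2\cdots a_{m-1})}q^{m-1},\] i.e. $c_{XY}(x,q)=\sum_{j=0}^{m-1}c_j\,x^{w(a_{m-j}\cdots a_{m-1})}q^{j}$. We write $c_{ij}(x,q)=c_{S_iS_j}(x,q)$. -}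

module Defs where

open import Data.Bool.Base using (true; false; if_then_else_; _∧_)
open import Data.Empty using (⊥-elim)
open import Data.Fin.Base using (Fin; zero; suc; toℕ)
open import Data.Fin.Properties using (all?; toℕ≤pred[n])
open import Data.Integer.Base as ℤ using (ℤ; +_; 0ℤ; 1ℤ)
import Data.Integer.Properties as ℤₚ
open import Data.List.Base using (List; []; _∷_; length; take; drop; map; concatMap; filter; upTo)
open import Data.List.Membership.Propositional using (_∈_; find; lose)
open import Data.List.Membership.Propositional.Properties using (∈-concatMap⁺; ∈-concatMap⁻; ∈-map⁺; ∈-map⁻; ∈-upTo⁺; ∈-upTo⁻)
open import Data.List.Properties using (∷-injective; ∷-injectiveʳ; take-all)
open import Data.List.Relation.Binary.Infix.Heterogeneous using (Infix)
open import Data.List.Relation.Binary.Infix.Heterogeneous.Properties using (infix?)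
open import Data.List.Relation.Binary.Pointwise using (≡⇒Pointwise-≡)
open import Data.List.Relation.Binary.Suffix.Heterogeneous using (Suffix; here)
open import Data.List.Relation.Binary.Suffix.Heterogeneous.Properties using (suffix?)
open import Data.List.Relation.Unary.All using (All; []; _∷_)
import Data.List.Relation.Unary.All.Properties as All
import Data.List.Relation.Unary.AllPairs as AllPairs
import Data.List.Relation.Unary.AllPairs.Properties as AllPairs
open import Data.List.Relation.Unary.Any using (here)
open import Data.List.Relation.Unary.Unique.Propositional using (Unique)
import Data.List.Relation.Unary.Unique.Propositional.Properties as Unique
open import Data.Nat.Base as ℕ using (ℕ; zero; suc; _∸_; _≡ᵇ_; _<_; _≤_; s≤s; s≤s⁻¹; z≤n; NonZero; _≤′_; ≤′-refl; ≤′-step)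
open import Data.Nat.ListAction using (sum)
import Data.Nat.Properties as ℕₚ
open import Data.Product.Base using (_×_; _,_; proj₁)
open import Function.Base using (_∘_)
open import Function.Bundles using (_⇔_; mk⇔)
open import Relation.Binary.PropositionalEquality using (_≡_; _≢_; refl; sym; trans; cong; cong₂; subst; module ≡-Reasoning)
open import Relation.Nullary using (¬_; Dec; does; ¬?)
open import Relation.Nullary.Decidable using (dec-true)
open import Algebra.Properties.AbelianGroup ℤₚ.+-0-abelianGroup using (∙-cancelˡ)
open import Algebra.Properties.Semiring.Sum ℤₚ.+-*-semiring as Sum using (sum-syntax; sum⁺-syntax; sum-cong-≗; sum-replicate-zero; ∑-distrib-+)

------------------------------------------------------------------------
-- Formal power series in x and q over ℤ

-- f a b is the coefficient of x^a q^b.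
Series : Set
Series = ℕ → ℕ → ℤ

infix 4 _≈_
_≈_ : Series → Series → Set
f ≈ g = ∀ a b → f a b ≡ g a b

monomial : ℕ → ℕ → Series
monomial a b i j = if (a ≡ᵇ i) ∧ (b ≡ᵇ j) then 1ℤ else 0ℤ

0# 1# x q : Series
0# _ _ = 0ℤ
1# = monomial 0 0
x  = monomial 1 0
q  = monomial 0 1

infixl 6 _+_ _-_
infixl 7 _*_ _/_
infix  8 1/_

_+_ _-_ _*_ : Series → Series → Series
(f + g) a b = f a b ℤ.+ g a b
(f - g) a b = f a b ℤ.- g a b
(f * g) a b = ∑[ i ≤ a ] ∑[ j ≤ b ] (f (toℕ i) (toℕ j) ℤ.* g (a ∸ toℕ i) (b ∸ toℕ j))

∑ : ∀ {k} → (Fin k → Series) → Series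
∑ {k} f a b = ∑[ i < k ] f i a b

-- geometric f n = 1 + (1 - f) + ... + (1 - f)^(n-1)
geometric : Series → ℕ → Series
geometric f zero    = 0#
geometric f (suc n) = 1# + (1# - f) * geometric f n

-- The multiplicative inverse of a series with constant term 1, see
-- *-inverseʳ; no meaning is attached to it for other series. The
-- coefficient of x^a q^b in (1 - f)^n is 0 for n > a + b.
1/_ : Series → Series
(1/ f) a b = geometric f (suc (a ℕ.+ b)) a b

_/_ : Series → Series → Series
f / g = f * 1/ g

------------------------------------------------------------------------
-- Words and compositions

Word : Set
Word = List ℕ

IsComposition : Word → Set
IsComposition = All NonZero

weight : Word → ℕ
weight = sum

infix 4 _⊑_ _⊑?_
_⊑_ : Word → Word → Set
_⊑_ = Infix _≡_

_⊑?_ : ∀ S σ → Dec (S ⊑ σ)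
_⊑?_ = infix? ℕₚ._≟_

Avoids : ∀ {k} → (Fin k → Word) → Word → Set
Avoids S σ = ∀ j → ¬ (S j ⊑ σ)

avoids? : ∀ {k} (S : Fin k → Word) σ → Dec (Avoids S σ)
avoids? S σ = all? (λ j → ¬? (S j ⊑? σ))

-- The compositions of n with m parts, see ∈-compositions and
-- compositions-unique.
compositions : (n m : ℕ) → List Word
compositions n       (suc m) =
  concatMap (λ i → map (suc i ∷_) (compositions (n ∸ suc i) m)) (upTo n)
compositions zero    zero    = [] ∷ []
compositions (suc n) zero    = []

avoidanceSeries : ∀ {k} → (Fin k → Word) → Series
avoidanceSeries S n m = + length (filter (avoids? S) (compositions n m))

-- A suffix of Y equal to the prefix of X of length m ∸ j has length
-- m ∸ j, so its existence includes the condition m ∸ j ≤ length Y.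
correlation : Word → Word → Series
correlation X Y = ∑ term
  where
  m = length X
  term : Fin m → Series
  term j =
    if does (suffix? ℕₚ._≟_ (take (m ∸ toℕ j) X) Y)
    then monomial (weight (drop (m ∸ toℕ j) X)) (toℕ j)
    else 0#

------------------------------------------------------------------------
-- compositions n m lists each composition of n with m parts once

private
  ∈-compositions⁺ : ∀ σ → IsComposition σ → σ ∈ compositions (weight σ) (length σ)
  ∈-compositions⁺ []          []       = here refl
  ∈-compositions⁺ (suc i ∷ σ) (_ ∷ ps) =
    ∈-concatMap⁺ _ (lose (∈-upTo⁺ (s≤s (ℕₚ.m≤m+n i (weight σ))))
      (∈-map⁺ (suc i ∷_)
        (subst (λ n → σ ∈ compositions n (length σ))
               (sym (ℕₚ.m+n∸m≡n i (weight σ)))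
               (∈-compositions⁺ σ ps))))

  ∈-compositions⁻ : ∀ n m {σ} → σ ∈ compositions n m →
                    IsComposition σ × weight σ ≡ n × length σ ≡ m
  ∈-compositions⁻ zero zero (here refl) = [] , refl , refl
  ∈-compositions⁻ n (suc m) σ∈
    with i , i∈ , σ∈′ ← find (∈-concatMap⁻ (λ i → map (suc i ∷_) (compositions (n ∸ suc i) m)) {xs = upTo n} σ∈)
    with τ , τ∈ , refl ← ∈-map⁻ (suc i ∷_) σ∈′
    with ps , w≡ , l≡ ← ∈-compositions⁻ (n ∸ suc i) m τ∈ =
      _ ∷ ps
    , trans (cong (suc i ℕ.+_) w≡) (ℕₚ.m+[n∸m]≡n (∈-upTo⁻ i∈))
    , cong suc l≡

∈-compositions : ∀ n m σ →
  σ ∈ compositions n m ⇔ (IsComposition σ × weight σ ≡ n × length σ ≡ m)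
∈-compositions n m σ =
  mk⇔ (∈-compositions⁻ n m) (λ { (ps , refl , refl) → ∈-compositions⁺ σ ps })

compositions-unique : ∀ n m → Unique (compositions n m)
compositions-unique zero    zero    = [] AllPairs.∷ AllPairs.[]
compositions-unique (suc n) zero    = AllPairs.[]
compositions-unique n       (suc m) =
  Unique.concat⁺
    (All.map⁺ (All.applyUpTo⁺₂ _ n λ i →
      Unique.map⁺ ∷-injectiveʳ (compositions-unique (n ∸ suc i) m)))
    (AllPairs.map⁺ (AllPairs.map disjoint (Unique.upTo⁺ n)))
  where
  disjoint : ∀ {i j} → i ≢ j → ∀ {σ} →
    ¬ (σ ∈ map (suc i ∷_) (compositions (n ∸ suc i) m) ×
       σ ∈ map (suc j ∷_) (compositions (n ∸ suc j) m))
  disjoint i≢j (p , r)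
    with _ , _ , refl ← ∈-map⁻ _ p
    with _ , _ , eq ← ∈-map⁻ _ r = i≢j (ℕₚ.suc-injective (proj₁ (∷-injective eq)))

------------------------------------------------------------------------
-- 1/ f is inverse to f when f has constant term 1

private
  sum-zero : ∀ {n} (t : Fin n → ℤ) → (∀ i → t i ≡ 0ℤ) → Sum.sum t ≡ 0ℤ
  sum-zero {n} t t≡0 = trans (sum-cong-≗ t≡0) (sum-replicate-zero n)

  sum-neg : ∀ {n} (t : Fin n → ℤ) → Sum.sum (λ i → ℤ.- t i) ≡ ℤ.- Sum.sum t
  sum-neg {zero}  t = refl
  sum-neg {suc n} t =
    trans (cong (λ s → ℤ.- t zero ℤ.+ s) (sum-neg (t ∘ suc)))
          (sym (ℤₚ.neg-distrib-+ (t zero) _))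

  sum-sub : ∀ {n} (s t : Fin n → ℤ) →
            Sum.sum (λ i → s i ℤ.- t i) ≡ Sum.sum s ℤ.- Sum.sum t
  sum-sub s t = trans (∑-distrib-+ s (λ i → ℤ.- t i))
                      (cong (λ u → Sum.sum s ℤ.+ u) (sum-neg t))

  *-distribʳ-- : ∀ f g h → (f - g) * h ≈ f * h - g * h
  *-distribʳ-- f g h a b = trans
    (sum-cong-≗ {suc a} λ i → trans
      (sum-cong-≗ {suc b} λ j → term (f (toℕ i) (toℕ j)) (g (toℕ i) (toℕ j)) (h (a ∸ toℕ i) (b ∸ toℕ j)))
      (sum-sub {suc b} (T f i) (T g i)))
    (sum-sub {suc a} (λ i → Sum.sum (T f i)) (λ i → Sum.sum (T g i)))
    where
    T : Series → Fin (suc a) → Fin (suc b) → ℤ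
    T s i j = s (toℕ i) (toℕ j) ℤ.* h (a ∸ toℕ i) (b ∸ toℕ j)

    term : ∀ u v w → (u ℤ.- v) ℤ.* w ≡ u ℤ.* w ℤ.- v ℤ.* w
    term u v w = trans (ℤₚ.*-distribʳ-+ w u (ℤ.- v))
                       (cong (λ t → u ℤ.* w ℤ.+ t) (sym (ℤₚ.neg-distribˡ-* v w)))

  *-identityˡ : ∀ f → 1# * f ≈ f
  *-identityˡ f a b = trans
    (cong₂ ℤ._+_
      (trans (cong₂ ℤ._+_ (ℤₚ.*-identityˡ (f a b)) (sum-zero {b} _ λ _ → refl))
             (ℤₚ.+-identityʳ (f a b)))
      (sum-zero {a} _ λ _ → sum-zero {suc b} _ λ _ → refl))
    (ℤₚ.+-identityʳ (f a b))

  *-local : ∀ h → h 0 0 ≡ 0ℤ → ∀ f g a b →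
    (∀ i j → i ℕ.+ j < a ℕ.+ b → f i j ≡ g i j) → (h * f) a b ≡ (h * g) a b
  *-local h h₀ f g a b f≡g =
    sum-cong-≗ {suc a} λ i → sum-cong-≗ {suc b} λ j →
      term (toℕ i) (toℕ j) (toℕ≤pred[n] i) (toℕ≤pred[n] j)
    where
    term : ∀ i j → i ≤ a → j ≤ b →
           h i j ℤ.* f (a ∸ i) (b ∸ j) ≡ h i j ℤ.* g (a ∸ i) (b ∸ j)
    term zero    zero    _   _   rewrite h₀ = refl
    term zero    (suc j) _   j<b = cong (λ u → h zero (suc j) ℤ.* u) (f≡g _ _
      (ℕₚ.+-monoʳ-< a (ℕₚ.∸-monoʳ-< (s≤s z≤n) j<b)))
    term (suc i) j       i<a _   = cong (λ u → h (suc i) j ℤ.* u) (f≡g _ _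
      (ℕₚ.+-mono-<-≤ (ℕₚ.∸-monoʳ-< (s≤s z≤n) i<a) (ℕₚ.m∸n≤m b j)))

module _ (f : Series) (f₀ : f 0 0 ≡ 1ℤ) where
  private
    h = 1# - f

    h₀ : h 0 0 ≡ 0ℤ
    h₀ rewrite f₀ = refl

    step : ∀ n a b → a ℕ.+ b < n → geometric f n a b ≡ geometric f (suc n) a b
    step (suc n) a b p = cong (λ u → 1# a b ℤ.+ u)
      (*-local h h₀ _ _ a b λ i j r → step n i j (ℕₚ.<-≤-trans r (s≤s⁻¹ p)))

    stable : ∀ {n} a b → suc (a ℕ.+ b) ≤′ n → (1/ f) a b ≡ geometric f n a b
    stable a b ≤′-refl     = refl
    stable a b (≤′-step p) = trans (stable a b p) (step _ a b (ℕₚ.≤′⇒≤ p))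

    fixpoint : 1/ f ≈ 1# + h * 1/ f
    fixpoint a b = cong (λ u → 1# a b ℤ.+ u)
      (*-local h h₀ _ _ a b λ i j r → sym (stable i j (ℕₚ.≤⇒≤′ r)))

    cancel : ∀ g u p → g ≡ u ℤ.+ (g ℤ.- p) → p ≡ u
    cancel g u p eq = ∙-cancelˡ (g ℤ.- p) p u (begin
      (g ℤ.- p) ℤ.+ p         ≡⟨ ℤₚ.+-assoc g (ℤ.- p) p ⟩
      g ℤ.+ (ℤ.- p ℤ.+ p)     ≡⟨ cong (λ v → g ℤ.+ v) (ℤₚ.+-inverseˡ p) ⟩
      g ℤ.+ 0ℤ                ≡⟨ ℤₚ.+-identityʳ g ⟩
      g                       ≡⟨ eq ⟩
      u ℤ.+ (g ℤ.- p)         ≡⟨ ℤₚ.+-comm u _ ⟩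
      (g ℤ.- p) ℤ.+ u         ∎)
      where open ≡-Reasoning

  *-inverseʳ : f * 1/ f ≈ 1#
  *-inverseʳ a b = cancel ((1/ f) a b) (1# a b) _ (trans (fixpoint a b)
    (cong (λ u → 1# a b ℤ.+ u) (trans (*-distribʳ-- 1# f (1/ f) a b)
      (cong (λ u → u ℤ.- (f * 1/ f) a b) (*-identityˡ (1/ f) a b)))))

------------------------------------------------------------------------
-- The series inverted in the formula for avoidanceSeries have constant
-- term 1 (for 1# - x this holds by refl)

correlation-constant : ∀ X → X ≢ [] → correlation X X 0 0 ≡ 1ℤ
correlation-constant []        X≢[] = ⊥-elim (X≢[] refl)
correlation-constant X@(a ∷ w) _    = cong₂ ℤ._+_ head-term (sum-zero {length w} _ tail-term)
  where
  drop-all : ∀ (v : Word) → drop (length v) v ≡ []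
  drop-all []      = refl
  drop-all (_ ∷ v) = drop-all v

  head-term : (if does (suffix? ℕₚ._≟_ (take (length X) X) X)
               then monomial (weight (drop (length X) X)) 0 else 0#) 0 0 ≡ 1ℤ
  head-term
    rewrite dec-true (suffix? ℕₚ._≟_ (take (length X) X) X)
                     (here (≡⇒Pointwise-≡ (take-all (length X) X ℕₚ.≤-refl)))
          | drop-all w = refl

  monomial-0 : ∀ n m → monomial n (suc m) 0 0 ≡ 0ℤ
  monomial-0 zero    m = refl
  monomial-0 (suc n) m = refl

  tail-term : ∀ (j : Fin (length w)) →
    (if does (suffix? ℕₚ._≟_ (take (length w ∸ toℕ j) X) X)
     then monomial (weight (drop (length w ∸ toℕ j) X)) (suc (toℕ j)) else 0#) 0 0 ≡ 0ℤ
  tail-term j with does (suffix? ℕₚ._≟_ (take (length w ∸ toℕ j) X) X)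
  ... | true  = monomial-0 (weight (drop (length w ∸ toℕ j) X)) (toℕ j)
  ... | false = refl

denominator-constant : ∀ {k} (S : Fin k → Word) → (∀ j → S j ≢ []) →
  (1# - q * x / (1# - x) + ∑ (λ j → monomial (weight (S j)) (length (S j)) / correlation (S j) (S j))) 0 0 ≡ 1ℤ
denominator-constant S S≢[] =
  cong (λ u → 1ℤ ℤ.+ u) (sum-zero _ λ j → term (S j) (S≢[] j))
  where
  term : ∀ X → X ≢ [] → (monomial (weight X) (length X) / correlation X X) 0 0 ≡ 0ℤ
  term []      X≢[] = ⊥-elim (X≢[] refl)
  term X@(a ∷ w) _ with weight X
  ... | zero  = refl
  ... | suc _ = refl

{-# OPTIONS --safe #-}

-- Let F enumerate the words avoiding the list, and B_j the words in which
-- the first occurrence of a listed word is an S_j at the very end. Appending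
-- a letter to an avoiding word gives
--   1 + F · qx/(1 - x) = F + ∑ B_j,
-- and appending S_j to an avoiding word gives F · x^w(S_j) q^ℓ(S_j) = B_j · c_jj:
-- the first occurrence in σ S_j overlaps a prefix of S_j, so it is an S_j by
-- the vanishing of the other correlations. Eliminating the B_j yields
-- F · D = 1 for the denominator D. Both equations hold already between formal
-- sums of words; the letter a is then sent to x^a q.
module Submission where

open import Defs
open import Data.Nat.Base as ℕ using (ℕ; zero; suc; _∸_; _<_; s≤s)
open import Data.Fin.Base using (Fin; zero; suc; toℕ; fromℕ<)
open import Data.List.Base using (List; []; _∷_; _++_; _∷ʳ_; length; map; concatMap; filter; applyUpTo; take; drop; InitLast; initLast; _∷ʳ′_)
open import Relation.Binary.PropositionalEquality using (_≡_; _≢_; refl; sym; trans; cong; cong₂; subst; module ≡-Reasoning)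
open import Relation.Nullary using (¬_; Dec; yes; no; does; ¬?; contradiction)
open import Algebra.Bundles using (Ring; RawRing)
import Algebra.Construct.Pointwise as Pointwise
import Algebra.Morphism.RingMonomorphism as RingMonomorphism
open import Algebra.Morphism.Structures using (IsRingMonomorphism)
import Algebra.Properties.CommutativeSemigroup as CommutativeSemigroupProperties
open import Algebra.Properties.Ring using (-‿distribʳ-*)
import Algebra.Properties.Semiring.Sum as SemiringSum
open import Data.Bool.Base using (true; false; if_then_else_)
import Data.Fin.Properties as Finₚ
open import Data.Integer.Base as ℤ using (ℤ; +_; 0ℤ; 1ℤ)
import Data.Integer.Properties as ℤₚ
import Data.List.Membership.DecPropositional as DecMembership
import Data.List.Properties as Listₚ
open import Data.List.Relation.Binary.Infix.Heterogeneous as Infix using (MkView)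
open import Data.List.Relation.Binary.Pointwise using (≡⇒Pointwise-≡; Pointwise-≡⇒≡)
open import Data.List.Relation.Binary.Suffix.Heterogeneous as Suffix using (Suffix)
open import Data.List.Relation.Binary.Suffix.Heterogeneous.Properties using (suffix?)
open import Data.List.Relation.Unary.All as All using ([])
import Data.List.Relation.Unary.All.Properties as Allₚ
open import Data.List.Relation.Unary.AllPairs using (_∷_)
open import Data.List.Relation.Unary.Unique.Propositional using (Unique)
import Data.Nat.Properties as ℕₚ
open import Data.Product.Base using (∃; ∃₂; _×_; _,_; proj₁; proj₂)
open import Data.Sum.Base using (_⊎_; inj₁; inj₂)
open import Data.Unit.Base using (tt)
open import Function.Base using (_∘_; id)
open import Function.Bundles using (Equivalence)
open import Level using (0ℓ)
import Relation.Binary.Reasoning.Setoid as SetoidReasoning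
open import Relation.Nullary.Decidable using (dec-true; dec-false; _×-dec_; map′; decidable-stable)
open import Relation.Unary using (Pred; Decidable)

open CommutativeSemigroupProperties ℤₚ.+-commutativeSemigroup using (interchange; xy∙z≈xz∙y)
open SemiringSum ℤₚ.+-*-semiring using (sum; sum-cong-≗; sum-replicate-zero; ∑-distrib-+; *-distribˡ-sum)

-- The ring of power series

-- The base ring is a parameter so that the construction can be iterated: first series in q over the
-- integers, then series in x over those, matching the order of the indices in `Series`.
module PowerSeries {c ℓ} (R : Ring c ℓ) where
  open Ring R
    renaming ( _≈_ to _≈ᴿ_; _+_ to _⊕_; _*_ to _⊙_; -_ to ⊖_; 0# to 𝟘; 1# to 𝟙
             ; sym to symᴿ; trans to transᴿ )
  open CommutativeSemigroupProperties +-commutativeSemigroup using () renaming (interchange to +-interchange)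

  infix  4 _≋_
  infixl 7 _⊛_

  _≋_ : (f g : ℕ → Carrier) → Set ℓ
  f ≋ g = ∀ n → f n ≈ᴿ g n

  -- The Cauchy product, computed from f = f 0 + x · (f ∘ suc).
  _⊛_ : (f g : ℕ → Carrier) → ℕ → Carrier
  (f ⊛ g) zero    = f 0 ⊙ g 0
  (f ⊛ g) (suc n) = f 0 ⊙ g (suc n) ⊕ (f ∘ suc ⊛ g) n

  one : ℕ → Carrier
  one zero    = 𝟙
  one (suc n) = 𝟘

  ⊛-cong : ∀ {f f′ g g′} → f ≋ f′ → g ≋ g′ → f ⊛ g ≋ f′ ⊛ g′
  ⊛-cong f≋ g≋ zero    = *-cong (f≋ 0) (g≋ 0)
  ⊛-cong f≋ g≋ (suc n) = +-cong (*-cong (f≋ 0) (g≋ (suc n))) (⊛-cong (f≋ ∘ suc) g≋ n)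

  ⊛-distribˡ : ∀ f g h → f ⊛ (λ n → g n ⊕ h n) ≋ λ n → (f ⊛ g) n ⊕ (f ⊛ h) n
  ⊛-distribˡ f g h zero    = distribˡ _ _ _
  ⊛-distribˡ f g h (suc n) =
    transᴿ (+-cong (distribˡ _ _ _) (⊛-distribˡ (f ∘ suc) g h n)) (+-interchange _ _ _ _)

  ⊛-distribʳ : ∀ f g h → (λ n → g n ⊕ h n) ⊛ f ≋ λ n → (g ⊛ f) n ⊕ (h ⊛ f) n
  ⊛-distribʳ f g h zero    = distribʳ _ _ _
  ⊛-distribʳ f g h (suc n) =
    transᴿ (+-cong (distribʳ _ _ _) (⊛-distribʳ f (g ∘ suc) (h ∘ suc) n)) (+-interchange _ _ _ _)

  ⊛-scaleˡ : ∀ a f g → (λ n → a ⊙ f n) ⊛ g ≋ λ n → a ⊙ (f ⊛ g) n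
  ⊛-scaleˡ a f g zero    = *-assoc _ _ _
  ⊛-scaleˡ a f g (suc n) =
    transᴿ (+-cong (*-assoc _ _ _) (⊛-scaleˡ a (f ∘ suc) g n)) (symᴿ (distribˡ _ _ _))

  -- The tail `(f ⊛ g) ∘ suc` is `g ∘ suc` scaled by `f 0`, plus `f ∘ suc ⊛ g`. Distributivity and
  -- scaling separate the two, and induction applies to `f ∘ suc`.
  ⊛-assoc : ∀ f g h → (f ⊛ g) ⊛ h ≋ f ⊛ (g ⊛ h)
  ⊛-assoc f g h zero    = *-assoc _ _ _
  ⊛-assoc f g h (suc n) = begin
    f 0 ⊙ g 0 ⊙ h (suc n) ⊕ ((f ⊛ g) ∘ suc ⊛ h) n
      ≈⟨ +-cong (*-assoc _ _ _) (⊛-distribʳ h (λ m → f 0 ⊙ g (suc m)) (f ∘ suc ⊛ g) n) ⟩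
    f 0 ⊙ (g 0 ⊙ h (suc n)) ⊕ (((λ m → f 0 ⊙ g (suc m)) ⊛ h) n ⊕ ((f ∘ suc ⊛ g) ⊛ h) n)
      ≈⟨ +-congˡ (+-cong (⊛-scaleˡ (f 0) (g ∘ suc) h n) (⊛-assoc (f ∘ suc) g h n)) ⟩
    f 0 ⊙ (g 0 ⊙ h (suc n)) ⊕ (f 0 ⊙ (g ∘ suc ⊛ h) n ⊕ (f ∘ suc ⊛ (g ⊛ h)) n)
      ≈⟨ +-assoc _ _ _ ⟨
    f 0 ⊙ (g 0 ⊙ h (suc n)) ⊕ f 0 ⊙ (g ∘ suc ⊛ h) n ⊕ (f ∘ suc ⊛ (g ⊛ h)) n
      ≈⟨ +-congʳ (distribˡ _ _ _) ⟨
    (f ⊛ (g ⊛ h)) (suc n) ∎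
    where open SetoidReasoning setoid

  ⊛-zeroˡ : ∀ f → (λ _ → 𝟘) ⊛ f ≋ λ _ → 𝟘
  ⊛-zeroˡ f zero    = zeroˡ _
  ⊛-zeroˡ f (suc n) = transᴿ (+-cong (zeroˡ _) (⊛-zeroˡ f n)) (+-identityˡ _)

  ⊛-identityˡ : ∀ f → one ⊛ f ≋ f
  ⊛-identityˡ f zero    = *-identityˡ _
  ⊛-identityˡ f (suc n) = transᴿ (+-cong (*-identityˡ _) (⊛-zeroˡ f n)) (+-identityʳ _)

  ⊛-identityʳ : ∀ f → f ⊛ one ≋ f
  ⊛-identityʳ f zero    = *-identityʳ _
  ⊛-identityʳ f (suc n) = transᴿ (+-cong (zeroʳ _) (⊛-identityʳ (f ∘ suc) n)) (+-identityˡ _)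

  ring : Ring c ℓ
  ring = record
    { Carrier = ℕ → Carrier
    ; _≈_     = _≋_
    ; _+_     = λ f g n → f n ⊕ g n
    ; _*_     = _⊛_
    ; -_      = λ f n → ⊖ f n
    ; 0#      = λ _ → 𝟘
    ; 1#      = one
    ; isRing  = record
      { +-isAbelianGroup = Pointwise.isAbelianGroup ℕ +-isAbelianGroup
      ; *-cong           = ⊛-cong
      ; *-assoc          = ⊛-assoc
      ; *-identity       = ⊛-identityˡ , ⊛-identityʳ
      ; distrib          = ⊛-distribˡ , ⊛-distribʳ
      }
    }

-- Transfer of the ring structure to `Series`

module ℤ⟦q⟧    = PowerSeries ℤₚ.+-*-ring
module ℤ⟦q⟧⟦x⟧ = PowerSeries ℤ⟦q⟧.ring

cauchy : ∀ (f g : ℕ → ℤ) n → sum {suc n} (λ i → f (toℕ i) ℤ.* g (n ∸ toℕ i)) ≡ (f ℤ⟦q⟧.⊛ g) n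
cauchy f g zero    = ℤₚ.+-identityʳ _
cauchy f g (suc n) = cong (λ u → f 0 ℤ.* g (suc n) ℤ.+ u) (cauchy (f ∘ suc) g n)

-- The outer sum over powers of x unfolds one term at a time, and `cauchy` evaluates the inner sum
-- over powers of q.
*-⊛ : ∀ f g → f * g ≈ f ℤ⟦q⟧⟦x⟧.⊛ g
*-⊛ f g zero    b = trans (ℤₚ.+-identityʳ _) (cauchy (f 0) (g 0) b)
*-⊛ f g (suc a) b = cong₂ ℤ._+_ (cauchy (f 0) (g (suc a)) b) (*-⊛ (f ∘ suc) g a b)

rawSeriesRing : RawRing 0ℓ 0ℓ
rawSeriesRing = record
  { Carrier = Series ; _≈_ = _≈_ ; _+_ = _+_ ; _*_ = _*_ ; -_ = λ f a b → ℤ.- f a b ; 0# = 0# ; 1# = 1# }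

-- Both rings have the same elements and the same equality, so the ring axioms for the double-sum
-- product pull back along the identity.
id-isRingMonomorphism : IsRingMonomorphism rawSeriesRing (Ring.rawRing ℤ⟦q⟧⟦x⟧.ring) id
id-isRingMonomorphism = record
  { isRingHomomorphism = record
    { isSemiringHomomorphism = record
      { isNearSemiringHomomorphism = record
        { +-isMonoidHomomorphism = record
          { isMagmaHomomorphism = record
            { isRelHomomorphism = record { cong = id }
            ; homo = λ f g a b → refl
            }
          ; ε-homo = λ a b → refl
          }
        ; *-homo = *-⊛
        }
      ; 1#-homo = 1#-one
      }
    ; -‿homo = λ f a b → refl
    }
  ; injective = id
  }
  where
  1#-one : 1# ≈ ℤ⟦q⟧⟦x⟧.one
  1#-one zero    zero    = refl
  1#-one zero    (suc b) = refl
  1#-one (suc a) b       = refl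

seriesRing : Ring 0ℓ 0ℓ
seriesRing = record
  { RawRing rawSeriesRing
  ; isRing = RingMonomorphism.isRing id-isRingMonomorphism (Ring.isRing ℤ⟦q⟧⟦x⟧.ring)
  }

module SeriesRing = Ring seriesRing
module SeriesSum = SemiringSum SeriesRing.semiring

sum-∑ : ∀ {k} (f : Fin k → Series) → SeriesSum.sum f ≈ ∑ f
sum-∑ {zero}  f a b = refl
sum-∑ {suc k} f a b = cong (λ u → f zero a b ℤ.+ u) (sum-∑ (f ∘ suc) a b)

∑-cong : ∀ {k} {f g : Fin k → Series} → (∀ i → f i ≈ g i) → ∑ f ≈ ∑ g
∑-cong f≈g a b = sum-cong-≗ (λ i → f≈g i a b)

*-distribˡ-∑ : ∀ {k} f (g : Fin k → Series) → f * ∑ g ≈ ∑ (λ i → f * g i)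
*-distribˡ-∑ f g = begin
  f * ∑ g               ≈⟨ SeriesRing.*-congˡ {f} (sum-∑ g) ⟨
  f * SeriesSum.sum g           ≈⟨ SeriesSum.*-distribˡ-sum f g ⟩
  SeriesSum.sum (λ i → f * g i) ≈⟨ sum-∑ (λ i → f * g i) ⟩
  ∑ (λ i → f * g i)     ∎
  where open SetoidReasoning SeriesRing.setoid

-- Quotients are identified by multiplying out, so the truncated geometric series behind `1/_` never
-- has to be computed with.
/-unique : ∀ f g h → g 0 0 ≡ 1ℤ → h * g ≈ f → f / g ≈ h
/-unique f g h g₀ hg≈f = begin
  f * 1/ g       ≈⟨ SeriesRing.*-congʳ {1/ g} hg≈f ⟨
  h * g * 1/ g   ≈⟨ SeriesRing.*-assoc h g (1/ g) ⟩
  h * (g * 1/ g) ≈⟨ SeriesRing.*-congˡ {h} (*-inverseʳ g g₀) ⟩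
  h * 1#         ≈⟨ SeriesRing.*-identityʳ h ⟩
  h              ∎
  where open SetoidReasoning SeriesRing.setoid

*-/-assoc : ∀ f g h → f * (g / h) ≈ f * g / h
*-/-assoc f g h = SeriesRing.sym {f * g / h} {f * (g / h)} (SeriesRing.*-assoc f g (1/ h))

*-distribˡ-- : ∀ f g h → f * (g - h) ≈ f * g - f * h
*-distribˡ-- f g h a b = trans (SeriesRing.distribˡ f g (SeriesRing.- h) a b)
  (cong (λ u → (f * g) a b ℤ.+ u) (sym (-‿distribʳ-* seriesRing f h a b)))

-- Iverson brackets and finite sums

[_] : ∀ {p} {P : Set p} → Dec P → ℤ
[ P? ] = if does P? then 1ℤ else 0ℤ

[]-true : ∀ {p} {P : Set p} (P? : Dec P) → P → [ P? ] ≡ 1ℤ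
[]-true P? p rewrite dec-true P? p = refl

[]-false : ∀ {p} {P : Set p} (P? : Dec P) → ¬ P → [ P? ] ≡ 0ℤ
[]-false P? ¬p rewrite dec-false P? ¬p = refl

[]-cong : ∀ {p r} {P : Set p} {R : Set r} (P? : Dec P) (R? : Dec R) → (P → R) → (R → P) → [ P? ] ≡ [ R? ]
[]-cong (yes p) R? f g = sym ([]-true R? (f p))
[]-cong (no ¬p) R? f g = sym ([]-false R? (¬p ∘ g))

sum-zero : ∀ {n} {t : Fin n → ℤ} → (∀ i → t i ≡ 0ℤ) → sum t ≡ 0ℤ
sum-zero {n} t≡0 = trans (sum-cong-≗ t≡0) (sum-replicate-zero n)

-- If `P zero` holds, uniqueness makes all other terms vanish; otherwise completeness passes to the
-- remaining indices. Case distinctions on words become identities of integers in this way.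
sum-indicator : ∀ {n p r} {P : Fin n → Set p} {R : Set r} (P? : ∀ i → Dec (P i)) (R? : Dec R) →
  (∀ i → P i → R) → (R → ∃ P) → (∀ i j → P i → P j → i ≡ j) → sum (λ i → [ P? i ]) ≡ [ R? ]
sum-indicator {zero}  P? R? sound complete unique = sym ([]-false R? λ r → Finₚ.¬Fin0 (proj₁ (complete r)))
sum-indicator {suc n} {P = P} {R} P? R? sound complete unique with P? zero
... | yes p₀ = begin
  1ℤ ℤ.+ sum (λ i → [ P? (suc i) ])
    ≡⟨ cong (λ u → 1ℤ ℤ.+ u) (sum-zero λ i → []-false (P? (suc i)) λ p → contradiction (unique zero (suc i) p₀ p) λ ()) ⟩
  1ℤ ≡⟨ []-true R? (sound zero p₀) ⟨
  [ R? ] ∎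
  where open ≡-Reasoning
... | no ¬p₀ = trans (ℤₚ.+-identityˡ _)
  (sum-indicator (P? ∘ suc) R? (sound ∘ suc) complete′
    λ i j p p′ → Finₚ.suc-injective (unique (suc i) (suc j) p p′))
  where
  complete′ : R → ∃ (P ∘ suc)
  complete′ r with complete r
  ... | zero  , p = contradiction p ¬p₀
  ... | suc i , p = i , p

sumOver : (Word → ℤ) → List Word → ℤ
sumOver f []       = 0ℤ
sumOver f (σ ∷ σs) = f σ ℤ.+ sumOver f σs

sumOver-cong : ∀ {f g} → (∀ σ → f σ ≡ g σ) → ∀ σs → sumOver f σs ≡ sumOver g σs
sumOver-cong f≗g []       = refl
sumOver-cong f≗g (σ ∷ σs) = cong₂ ℤ._+_ (f≗g σ) (sumOver-cong f≗g σs)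

sumOver-zero : ∀ σs → sumOver (λ _ → 0ℤ) σs ≡ 0ℤ
sumOver-zero []       = refl
sumOver-zero (σ ∷ σs) = trans (ℤₚ.+-identityˡ _) (sumOver-zero σs)

sumOver-+ : ∀ f g σs → sumOver (λ σ → f σ ℤ.+ g σ) σs ≡ sumOver f σs ℤ.+ sumOver g σs
sumOver-+ f g []       = refl
sumOver-+ f g (σ ∷ σs) = trans (cong (λ u → f σ ℤ.+ g σ ℤ.+ u) (sumOver-+ f g σs)) (interchange (f σ) (g σ) _ _)

sumOver-* : ∀ c f σs → sumOver (λ σ → c ℤ.* f σ) σs ≡ c ℤ.* sumOver f σs
sumOver-* c f []       = sym (ℤₚ.*-zeroʳ c)
sumOver-* c f (σ ∷ σs) = trans (cong (λ u → c ℤ.* f σ ℤ.+ u) (sumOver-* c f σs)) (sym (ℤₚ.*-distribˡ-+ c (f σ) _))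

sumOver-sum : ∀ {k} (f : Fin k → Word → ℤ) σs → sumOver (λ σ → sum (λ i → f i σ)) σs ≡ sum (λ i → sumOver (f i) σs)
sumOver-sum {zero}  f σs = sumOver-zero σs
sumOver-sum {suc k} f σs =
  trans (sumOver-+ (f zero) _ σs) (cong (λ u → sumOver (f zero) σs ℤ.+ u) (sumOver-sum (f ∘ suc) σs))

sumOver-++ : ∀ f σs τs → sumOver f (σs ++ τs) ≡ sumOver f σs ℤ.+ sumOver f τs
sumOver-++ f []       τs = sym (ℤₚ.+-identityˡ _)
sumOver-++ f (σ ∷ σs) τs = trans (cong (λ u → f σ ℤ.+ u) (sumOver-++ f σs τs)) (sym (ℤₚ.+-assoc (f σ) _ _))

sumOver-map : ∀ f a σs → sumOver f (map (a ∷_) σs) ≡ sumOver (f ∘ (a ∷_)) σs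
sumOver-map f a []       = refl
sumOver-map f a (σ ∷ σs) = cong (λ u → f (a ∷ σ) ℤ.+ u) (sumOver-map f a σs)

sumOver-concatMap : ∀ f (g : ℕ → List Word) h n →
  sumOver f (concatMap g (applyUpTo h n)) ≡ sum {n} (λ i → sumOver f (g (h (toℕ i))))
sumOver-concatMap f g h zero    = refl
sumOver-concatMap f g h (suc n) =
  trans (sumOver-++ f (g (h 0)) _) (cong (λ u → sumOver f (g (h 0)) ℤ.+ u) (sumOver-concatMap f g (h ∘ suc) n))

sumOver-filter : ∀ {p} {P : Pred Word p} (P? : Decidable P) σs → + length (filter P? σs) ≡ sumOver (λ σ → [ P? σ ]) σs
sumOver-filter P? []       = refl
sumOver-filter P? (σ ∷ σs) with does (P? σ)
... | true  = cong (λ u → 1ℤ ℤ.+ u) (sumOver-filter P? σs)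
... | false = trans (sumOver-filter P? σs) (sym (ℤₚ.+-identityˡ _))

infix 4 _≟_
_≟_ : (σ τ : Word) → Dec (σ ≡ τ)
_≟_ = Listₚ.≡-dec ℕₚ._≟_

open DecMembership _≟_ using (_∈?_)

-- The single word `τ` as a formal sum.
δ : Word → Word → ℤ
δ τ σ = [ τ ≟ σ ]

sumOver-δ : ∀ τ σs → Unique σs → sumOver (δ τ) σs ≡ [ τ ∈? σs ]
sumOver-δ τ []       _ = refl
sumOver-δ τ (σ ∷ σs) (σ∉ ∷ σs!) with τ ≟ σ
... | yes refl = cong (λ u → 1ℤ ℤ.+ u)
  (trans (sumOver-δ τ σs σs!) ([]-false (τ ∈? σs) λ τ∈σs → All.lookup σ∉ τ∈σs refl))
... | no _     = trans (ℤₚ.+-identityˡ _) (sumOver-δ τ σs σs!)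

-- Generating functions

-- The image of the noncommutative series ∑ f(σ) σ under a ↦ x^a q; words
-- with a letter 0 are ignored.
gf : (Word → ℤ) → Series
gf f n m = sumOver f (compositions n m)

gf-cong : ∀ {f g} → (∀ σ → f σ ≡ g σ) → gf f ≈ gf g
gf-cong f≗g n m = sumOver-cong f≗g (compositions n m)

gf-+ : ∀ f g → gf (λ σ → f σ ℤ.+ g σ) ≈ gf f + gf g
gf-+ f g n m = sumOver-+ f g (compositions n m)

gf-sum : ∀ {k} (f : Fin k → Word → ℤ) → gf (λ σ → sum (λ i → f i σ)) ≈ ∑ (λ i → gf (f i))
gf-sum f n m = sumOver-sum f (compositions n m)

gf-δ : ∀ σ → IsComposition σ → gf (δ σ) ≈ monomial (weight σ) (length σ)
gf-δ σ σ-comp n m = trans (sumOver-δ σ (compositions n m) (compositions-unique n m))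
  -- The bracket of these two equality tests computes to the coefficient in `monomial`.
  ([]-cong (σ ∈? compositions n m) ((weight σ ℕₚ.≟ n) ×-dec (length σ ℕₚ.≟ m))
    (proj₂ ∘ Equivalence.to (∈-compositions n m σ))
    (λ eqs → Equivalence.from (∈-compositions n m σ) (σ-comp , eqs)))

-- ∑ᵢ x^(i+1) P i
shifted : (ℕ → Series) → Series
shifted P n m = sum {n} (λ i → P (toℕ i) (n ∸ suc (toℕ i)) m)

gf-suc : ∀ f n m → gf f n (suc m) ≡ shifted (λ i → gf (f ∘ (suc i ∷_))) n m
gf-suc f n m = trans (sumOver-concatMap f (λ i → map (suc i ∷_) (compositions (n ∸ suc i) m)) id n)
  (sum-cong-≗ {n} λ i → sumOver-map f (suc (toℕ i)) (compositions (n ∸ suc (toℕ i)) m))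

-- As in Horner's scheme, `shifted P` is x times `P 0 + shifted (P ∘ suc)`; multiplication by `g`
-- distributes over this sum.
shifted-* : ∀ P g n m → (shifted P * g) n m ≡ shifted (λ i → P i * g) n m
shifted-* P g zero    m = trans (ℤₚ.+-identityʳ _) (sum-zero {suc m} λ j → ℤₚ.*-zeroˡ (g 0 (m ∸ toℕ j)))
shifted-* P g (suc n) m = begin
  (shifted P * g) (suc n) m
    ≡⟨ cong (λ u → u ℤ.+ ((shifted P ∘ suc) * g) n m) (sum-zero {suc m} λ j → ℤₚ.*-zeroˡ (g (suc n) (m ∸ toℕ j))) ⟩
  0ℤ ℤ.+ ((P 0 + shifted (P ∘ suc)) * g) n m
    ≡⟨ ℤₚ.+-identityˡ _ ⟩
  ((P 0 + shifted (P ∘ suc)) * g) n m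
    ≡⟨ SeriesRing.distribʳ g (P 0) (shifted (P ∘ suc)) n m ⟩
  (P 0 * g) n m ℤ.+ (shifted (P ∘ suc) * g) n m
    ≡⟨ cong (λ u → (P 0 * g) n m ℤ.+ u) (shifted-* (P ∘ suc) g n m) ⟩
  shifted (λ i → P i * g) (suc n) m ∎
  where open ≡-Reasoning

-- The product of noncommutative series: (f ⋆ g) τ = ∑_{τ = σ v} f σ · g v.
infixl 7 _⋆_
_⋆_ : (f g : Word → ℤ) → Word → ℤ
(f ⋆ g) []      = f [] ℤ.* g []
(f ⋆ g) (a ∷ σ) = f [] ℤ.* g (a ∷ σ) ℤ.+ ((f ∘ (a ∷_)) ⋆ g) σ

-- The exponent of q is the length of a word, so splitting off the q^0 part of `f` mirrors the case
-- of an empty left factor in `⋆`.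
*-expand-q : ∀ f g n m →
  (f * g) n (suc m) ≡ sum {suc n} (λ i → f (toℕ i) 0 ℤ.* g (n ∸ toℕ i) (suc m)) ℤ.+ ((λ i j → f i (suc j)) * g) n m
*-expand-q f g n m = ∑-distrib-+ {suc n}
  (λ i → f (toℕ i) 0 ℤ.* g (n ∸ toℕ i) (suc m))
  (λ i → sum {suc m} (λ j → f (toℕ i) (suc (toℕ j)) ℤ.* g (n ∸ toℕ i) (m ∸ toℕ j)))

-- The empty word is the only one of length 0, so only the term at index 0 survives.
gf-constant : ∀ f (h : ℕ → ℤ) n → sum {suc n} (λ i → gf f (toℕ i) 0 ℤ.* h (n ∸ toℕ i)) ≡ f [] ℤ.* h n
gf-constant f h n = begin
  (f [] ℤ.+ 0ℤ) ℤ.* h n ℤ.+ sum {n} (λ i → 0ℤ ℤ.* h (n ∸ suc (toℕ i)))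
    ≡⟨ cong₂ ℤ._+_ (cong (ℤ._* h n) (ℤₚ.+-identityʳ (f []))) (sum-zero {n} λ i → ℤₚ.*-zeroˡ (h (n ∸ suc (toℕ i)))) ⟩
  f [] ℤ.* h n ℤ.+ 0ℤ
    ≡⟨ ℤₚ.+-identityʳ _ ⟩
  f [] ℤ.* h n ∎
  where open ≡-Reasoning

-- The substitution of x^a q for the letter a is multiplicative. By induction on the power of q: the
-- left factor of a nonempty word is either empty or contains the first letter, which is then
-- stripped.
gf-⋆ : ∀ f g → gf (f ⋆ g) ≈ gf f * gf g
gf-⋆ f g n zero = begin
  gf (f ⋆ g) n 0 ≡⟨ constant n ⟩
  f [] ℤ.* gf g n 0 ≡⟨ gf-constant f (λ i → gf g i 0) n ⟨
  sum {suc n} (λ i → gf f (toℕ i) 0 ℤ.* gf g (n ∸ toℕ i) 0)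
    ≡⟨ sum-cong-≗ {suc n} (λ i → ℤₚ.+-identityʳ (gf f (toℕ i) 0 ℤ.* gf g (n ∸ toℕ i) 0)) ⟨
  (gf f * gf g) n 0 ∎
  where
  open ≡-Reasoning
  constant : ∀ n → gf (f ⋆ g) n 0 ≡ f [] ℤ.* gf g n 0
  constant zero    = trans (ℤₚ.+-identityʳ _) (cong (f [] ℤ.*_) (sym (ℤₚ.+-identityʳ (g []))))
  constant (suc n) = sym (ℤₚ.*-zeroʳ (f []))
gf-⋆ f g n (suc m) = begin
  gf (f ⋆ g) n (suc m)
    ≡⟨ gf-suc (f ⋆ g) n m ⟩
  sum {n} (λ i → gf (λ σ → f [] ℤ.* g (suc (toℕ i) ∷ σ) ℤ.+ (∂ f (toℕ i) ⋆ g) σ) (n ∸ suc (toℕ i)) m)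
    ≡⟨ sum-cong-≗ {n} (λ i → trans (gf-+ _ (∂ f (toℕ i) ⋆ g) (n ∸ suc (toℕ i)) m)
         (cong₂ ℤ._+_ (sumOver-* (f []) (∂ g (toℕ i)) (compositions (n ∸ suc (toℕ i)) m))
                      (gf-⋆ (∂ f (toℕ i)) g (n ∸ suc (toℕ i)) m))) ⟩
  sum {n} (λ i → f [] ℤ.* gf (∂ g (toℕ i)) (n ∸ suc (toℕ i)) m ℤ.+ (gf (∂ f (toℕ i)) * gf g) (n ∸ suc (toℕ i)) m)
    ≡⟨ ∑-distrib-+ {n} _ _ ⟩
  sum {n} (λ i → f [] ℤ.* gf (∂ g (toℕ i)) (n ∸ suc (toℕ i)) m) ℤ.+ shifted (λ i → gf (∂ f i) * gf g) n m
    ≡⟨ cong₂ ℤ._+_ (*-distribˡ-sum {n} (f []) _) (shifted-* (gf ∘ ∂ f) (gf g) n m) ⟨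
  f [] ℤ.* shifted (gf ∘ ∂ g) n m ℤ.+ (shifted (gf ∘ ∂ f) * gf g) n m
    ≡⟨ cong₂ ℤ._+_ (cong (f [] ℤ.*_) (sym (gf-suc g n m)))
                   (sum-cong-≗ {suc n} λ i → sum-cong-≗ {suc m} λ j →
                     cong (ℤ._* gf g (n ∸ toℕ i) (m ∸ toℕ j)) (sym (gf-suc f (toℕ i) (toℕ j)))) ⟩
  f [] ℤ.* gf g n (suc m) ℤ.+ ((λ i j → gf f i (suc j)) * gf g) n m
    ≡⟨ cong (λ u → u ℤ.+ ((λ i j → gf f i (suc j)) * gf g) n m) (gf-constant f (λ i → gf g i (suc m)) n) ⟨
  sum {suc n} (λ i → gf f (toℕ i) 0 ℤ.* gf g (n ∸ toℕ i) (suc m)) ℤ.+ ((λ i j → gf f i (suc j)) * gf g) n m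
    ≡⟨ *-expand-q (gf f) (gf g) n m ⟨
  (gf f * gf g) n (suc m) ∎
  where
  open ≡-Reasoning
  -- The left derivative by the letter i + 1.
  ∂ : (Word → ℤ) → ℕ → Word → ℤ
  ∂ h i σ = h (suc i ∷ σ)

-- The alphabet as a formal sum. The letter 0, which it also contains, is ignored by `gf`.
letter : Word → ℤ
letter []      = 0ℤ
letter (_ ∷ σ) = δ [] σ

*-x-zero : ∀ f b → (f * x) 0 b ≡ 0ℤ
*-x-zero f b = trans (ℤₚ.+-identityʳ _) (sum-zero {suc b} λ j → ℤₚ.*-zeroʳ (f 0 (toℕ j)))

*-x-suc : ∀ f a b → (f * x) (suc a) b ≡ f a b
*-x-suc f zero    b = begin
  (f * x) 1 b
    ≡⟨ cong₂ ℤ._+_ (cauchy (f 0) (x 1) b) (*-x-zero (f ∘ suc) b) ⟩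
  (f 0 ℤ⟦q⟧.⊛ x 1) b ℤ.+ 0ℤ
    ≡⟨ ℤₚ.+-identityʳ _ ⟩
  (f 0 ℤ⟦q⟧.⊛ x 1) b
    ≡⟨ ℤ⟦q⟧.⊛-cong {f 0} {f 0} {x 1} {ℤ⟦q⟧.one} (λ _ → refl) (λ { zero → refl ; (suc _) → refl }) b ⟩
  (f 0 ℤ⟦q⟧.⊛ ℤ⟦q⟧.one) b
    ≡⟨ ℤ⟦q⟧.⊛-identityʳ (f 0) b ⟩
  f 0 b ∎
  where open ≡-Reasoning
*-x-suc f (suc a) b =
  trans (cong₂ ℤ._+_ (sum-zero {suc b} λ j → ℤₚ.*-zeroʳ (f 0 (toℕ j))) (*-x-suc (f ∘ suc) a b)) (ℤₚ.+-identityˡ _)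

-- A letter is either 1, which accounts for the term of `q`, or one more than a smaller letter.
gf-letter-suc : ∀ a b → gf letter (suc a) b ≡ q a b ℤ.+ gf letter a b
gf-letter-suc zero    zero    = refl
gf-letter-suc (suc a) zero    = refl
gf-letter-suc a       (suc b) = begin
  gf letter (suc a) (suc b)                     ≡⟨ gf-suc letter (suc a) b ⟩
  gf (δ []) a b ℤ.+ shifted (λ _ → gf (δ [])) a b ≡⟨ cong₂ ℤ._+_ (gf-δ [] [] a b) (sym (gf-suc letter a b)) ⟩
  1# a b ℤ.+ gf letter a (suc b)                ≡⟨⟩
  q a (suc b) ℤ.+ gf letter a (suc b)           ∎
  where open ≡-Reasoning

-- Multiplying q(x + x^2 + ...) by 1 - x telescopes to q x.
gf-letter : q * x / (1# - x) ≈ gf letter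
gf-letter = /-unique (q * x) (1# - x) (gf letter) refl λ a b → begin
  (gf letter * (1# - x)) a b                     ≡⟨ *-distribˡ-- (gf letter) 1# x a b ⟩
  (gf letter * 1#) a b ℤ.- (gf letter * x) a b   ≡⟨ cong (ℤ._- (gf letter * x) a b) (SeriesRing.*-identityʳ (gf letter) a b) ⟩
  gf letter a b ℤ.- (gf letter * x) a b          ≡⟨ step a b ⟩
  (q * x) a b                                    ∎
  where
  open ≡-Reasoning
  step : ∀ a b → gf letter a b ℤ.- (gf letter * x) a b ≡ (q * x) a b
  step zero    b = trans (cong₂ ℤ._-_ (gf-letter-zero b) (*-x-zero (gf letter) b)) (sym (*-x-zero q b))
    where
    gf-letter-zero : ∀ b → gf letter 0 b ≡ 0ℤ
    gf-letter-zero zero    = refl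
    gf-letter-zero (suc b) = refl
  step (suc a) b = begin
    gf letter (suc a) b ℤ.- (gf letter * x) (suc a) b ≡⟨ cong₂ ℤ._-_ (gf-letter-suc a b) (*-x-suc (gf letter) a b) ⟩
    q a b ℤ.+ gf letter a b ℤ.- gf letter a b    ≡⟨ ℤₚ.+-assoc (q a b) _ _ ⟩
    q a b ℤ.+ (gf letter a b ℤ.- gf letter a b)  ≡⟨ cong (λ u → q a b ℤ.+ u) (ℤₚ.+-inverseʳ (gf letter a b)) ⟩
    q a b ℤ.+ 0ℤ                                 ≡⟨ ℤₚ.+-identityʳ _ ⟩
    q a b                                        ≡⟨ *-x-suc q a b ⟨
    (q * x) (suc a) b                            ∎

-- Factors and overlaps of words

⊑⁺ : ∀ u w v → w ⊑ u ++ w ++ v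
⊑⁺ u w v = Infix.fromView (MkView u (≡⇒Pointwise-≡ refl) v)

⊑⁻ : ∀ {w σ} → w ⊑ σ → ∃₂ λ u v → σ ≡ u ++ w ++ v
⊑⁻ w⊑σ with Infix.toView w⊑σ
... | MkView u w≋ v with refl ← Pointwise-≡⇒≡ w≋ = u , v , refl

⊑-++ˡ : ∀ {w σ} u → w ⊑ σ → w ⊑ u ++ σ
⊑-++ˡ u = u Infix.++ⁱ_

⊑-++ʳ : ∀ {w σ} v → w ⊑ σ → w ⊑ σ ++ v
⊑-++ʳ v = Infix._ⁱ++ v

infix 4 _⊒_ _⊒?_
_⊒_ : Word → Word → Set
w ⊒ σ = Suffix _≡_ w σ

_⊒?_ : ∀ w σ → Dec (w ⊒ σ)
_⊒?_ = suffix? ℕₚ._≟_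

⊒⁺ : ∀ u w → w ⊒ u ++ w
⊒⁺ u w = Suffix.fromView (u Suffix.++ ≡⇒Pointwise-≡ refl)

⊒⁻ : ∀ {w σ} → w ⊒ σ → ∃ λ u → σ ≡ u ++ w
⊒⁻ w⊒σ with Suffix.toView w⊒σ
... | u Suffix.++ w≋ with refl ← Pointwise-≡⇒≡ w≋ = u , refl

⊒⇒⊑ : ∀ {w σ} → w ⊒ σ → w ⊑ σ
⊒⇒⊑ {w} w⊒σ with u , refl ← ⊒⁻ w⊒σ = ⊑-++ˡ u (subst (w ⊑_) (Listₚ.++-identityʳ w) (⊑⁺ [] w []))

-- Levi's lemma, with the overlap in the second alternative nonempty so that the two alternatives
-- exclude each other.
++-≡-++ : ∀ (s t u v : Word) → s ++ t ≡ u ++ v →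
  (∃ λ e → s ≡ u ++ e × v ≡ e ++ t) ⊎ (∃₂ λ a e → u ≡ s ++ a ∷ e × t ≡ a ∷ e ++ v)
++-≡-++ s       t []      v eq = inj₁ (s , refl , sym eq)
++-≡-++ []      t (a ∷ u) v eq = inj₂ (a , u , refl , eq)
++-≡-++ (b ∷ s) t (a ∷ u) v eq with refl , eq′ ← Listₚ.∷-injective eq with ++-≡-++ s t u v eq′
... | inj₁ (e , s≡ , v≡)      = inj₁ (e , cong (b ∷_) s≡ , v≡)
... | inj₂ (a′ , e , u≡ , t≡) = inj₂ (a′ , e , cong (b ∷_) u≡ , t≡)

-- The support of the product of the indicator of `P` with the single word `v`, see `⋆-δ`.
EndsIn : ∀ {p} → Pred Word p → Word → Pred Word p
EndsIn P v τ = ∃ λ σ → τ ≡ σ ++ v × P σ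

endsIn? : ∀ {p} {P : Pred Word p} → Decidable P → ∀ v → Decidable (EndsIn P v)
endsIn? P? v τ with v ⊒? τ
... | no ¬v⊒τ = no λ { (σ , refl , _) → ¬v⊒τ (⊒⁺ σ v) }
... | yes v⊒τ with σ , refl ← ⊒⁻ v⊒τ =
  map′ (λ p → σ , refl , p) (λ { (σ′ , eq , p) → subst _ (sym (Listₚ.++-cancelʳ v σ σ′ eq)) p }) (P? σ)

⋆-δ-none : ∀ f v τ → (∀ σ → τ ≢ σ ++ v) → (f ⋆ δ v) τ ≡ 0ℤ
⋆-δ-none f v []      none = trans (cong (f [] ℤ.*_) ([]-false (v ≟ []) (none [] ∘ sym))) (ℤₚ.*-zeroʳ (f []))
⋆-δ-none f v (a ∷ τ) none = cong₂ ℤ._+_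
  (trans (cong (f [] ℤ.*_) ([]-false (v ≟ a ∷ τ) (none [] ∘ sym))) (ℤₚ.*-zeroʳ (f [])))
  (⋆-δ-none (f ∘ (a ∷_)) v τ λ σ → none (a ∷ σ) ∘ cong (a ∷_))

-- The right factors of a word have pairwise different lengths, so only one factorization
-- contributes.
⋆-δ-++ : ∀ f v σ → (f ⋆ δ v) (σ ++ v) ≡ f σ
⋆-δ-++ f []      [] = ℤₚ.*-identityʳ (f [])
⋆-δ-++ f (a ∷ v) [] = trans (cong₂ ℤ._+_
  (trans (cong (f [] ℤ.*_) ([]-true (a ∷ v ≟ a ∷ v) refl)) (ℤₚ.*-identityʳ (f [])))
  (⋆-δ-none (f ∘ (a ∷_)) (a ∷ v) v λ σ eq →
    ℕₚ.<-irrefl (cong length eq) (Listₚ.length-++-≤ʳ (a ∷ v) {σ})))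
  (ℤₚ.+-identityʳ (f []))
⋆-δ-++ f v (b ∷ σ) = trans (cong₂ ℤ._+_
  (trans (cong (f [] ℤ.*_) ([]-false (v ≟ b ∷ σ ++ v) λ eq →
    ℕₚ.<-irrefl (cong length eq) (s≤s (Listₚ.length-++-≤ʳ v {σ})))) (ℤₚ.*-zeroʳ (f [])))
  (⋆-δ-++ (f ∘ (b ∷_)) v σ))
  (ℤₚ.+-identityˡ (f (b ∷ σ)))

⋆-δ : ∀ {p} {P : Pred Word p} (P? : Decidable P) v τ →
  ((λ σ → [ P? σ ]) ⋆ δ v) τ ≡ [ endsIn? P? v τ ]
-- `endsIn?` branches on the same test, so its bracket reduces to 0 or to `[ P? σ ]`.
⋆-δ P? v τ with v ⊒? τ
... | no ¬v⊒τ = ⋆-δ-none _ v τ λ { σ refl → ¬v⊒τ (⊒⁺ σ v) }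
... | yes v⊒τ with σ , refl ← ⊒⁻ v⊒τ = ⋆-δ-++ _ v σ

∷ʳ-nonempty : ∀ (σ : Word) a → [] ≢ σ ∷ʳ a
∷ʳ-nonempty []      a ()
∷ʳ-nonempty (_ ∷ _) a ()

⋆-letter : ∀ f σ a → (f ⋆ letter) (σ ∷ʳ a) ≡ f σ
⋆-letter f []      a = trans (cong₂ ℤ._+_ (ℤₚ.*-identityʳ (f [])) (ℤₚ.*-zeroʳ (f (a ∷ [])))) (ℤₚ.+-identityʳ (f []))
⋆-letter f (b ∷ σ) a = trans
  (cong₂ ℤ._+_ (trans (cong (f [] ℤ.*_) ([]-false ([] ≟ σ ∷ʳ a) (∷ʳ-nonempty σ a))) (ℤₚ.*-zeroʳ (f [])))
               (⋆-letter (f ∘ (b ∷_)) σ a))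
  (ℤₚ.+-identityˡ (f (b ∷ σ)))

-- Overlap X Y j is the condition c_j = 1 in the correlation of X on Y, and
-- overhang X j is the word a_{m-j} ⋯ a_{m-1} in the exponent of its term.
Overlap : (X Y : Word) → Fin (length X) → Set
Overlap X Y j = take (length X ∸ toℕ j) X ⊒ Y

overlap? : ∀ X Y j → Dec (Overlap X Y j)
overlap? X Y j = take (length X ∸ toℕ j) X ⊒? Y

overhang : ∀ X → Fin (length X) → Word
overhang X j = drop (length X ∸ toℕ j) X

length-overhang : ∀ X j → length (overhang X j) ≡ toℕ j
length-overhang X j = trans (Listₚ.length-drop (length X ∸ toℕ j) X) (ℕₚ.m∸[m∸n]≡n (ℕₚ.<⇒≤ (Finₚ.toℕ<n j)))

take-nonempty : ∀ (X : Word) (j : Fin (length X)) → take (length X ∸ toℕ j) X ≢ []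
take-nonempty X@(_ ∷ _) j eq with length X ∸ toℕ j | ℕₚ.m<n⇒0<n∸m (Finₚ.toℕ<n j)
take-nonempty (_ ∷ _) j () | suc _ | _

-- The shift is the length of the overhang `v`; it is a legal index because the overlapping prefix
-- `a ∷ u` is nonempty.
overlap⁺ : ∀ {X Y} a u v → X ≡ a ∷ u ++ v → a ∷ u ⊒ Y → ∃ λ j → Overlap X Y j × overhang X j ≡ v
overlap⁺ {Y = Y} a u v refl u⊒Y = j , subst (_⊒ Y) (sym take≡) u⊒Y , drop≡
  where
  X = a ∷ u ++ v
  |v|<|X| : length v < length X
  |v|<|X| = s≤s (Listₚ.length-++-≤ʳ v {u})
  j = fromℕ< |v|<|X|
  kept : length X ∸ toℕ j ≡ length (a ∷ u)
  kept = begin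
    length X ∸ toℕ j                         ≡⟨ cong (length X ∸_) (Finₚ.toℕ-fromℕ< |v|<|X|) ⟩
    length X ∸ length v                      ≡⟨ cong (_∸ length v) (Listₚ.length-++ (a ∷ u)) ⟩
    length (a ∷ u) ℕ.+ length v ∸ length v   ≡⟨ ℕₚ.m+n∸n≡m (length (a ∷ u)) (length v) ⟩
    length (a ∷ u)                           ∎
    where open ≡-Reasoning
  take-length : ∀ w → take (length w) (w ++ v) ≡ w
  take-length []      = refl
  take-length (b ∷ w) = cong (b ∷_) (take-length w)
  drop-length : ∀ w → drop (length w) (w ++ v) ≡ v
  drop-length []      = refl
  drop-length (b ∷ w) = drop-length w
  take≡ : take (length X ∸ toℕ j) X ≡ a ∷ u
  take≡ = trans (cong (λ n → take n X) kept) (take-length (a ∷ u))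
  drop≡ : overhang X j ≡ v
  drop≡ = trans (cong (λ n → drop n X) kept) (drop-length (a ∷ u))

-- The summand local to `correlation`, repeated here so that `correlation X Y` is
-- `∑ (correlation-term X Y)` by computation.
correlation-term : ∀ X Y → Fin (length X) → Series
correlation-term X Y j = if does (overlap? X Y j) then monomial (weight (overhang X j)) (toℕ j) else 0#

-- Different shifts carry different powers of q, so terms cannot cancel: an overlap at shift `j`
-- would leave a coefficient 1.
correlation-zero : ∀ X Y → correlation X Y ≈ 0# → ∀ j → ¬ Overlap X Y j
correlation-zero X Y c≈0 j o = contradiction (trans (sym coefficient) (c≈0 a (toℕ j))) λ ()
  where
  a = weight (overhang X j)
  P? : ∀ i → Dec (Overlap X Y i × weight (overhang X i) ≡ a × toℕ i ≡ toℕ j)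
  P? i = overlap? X Y i ×-dec (weight (overhang X i) ℕₚ.≟ a) ×-dec (toℕ i ℕₚ.≟ toℕ j)
  term : ∀ i → correlation-term X Y i a (toℕ j) ≡ [ P? i ]
  term i with does (overlap? X Y i)
  ... | true  = refl
  ... | false = refl
  coefficient : correlation X Y a (toℕ j) ≡ 1ℤ
  coefficient = trans (sum-cong-≗ term) (sum-indicator P? (yes tt) (λ _ _ → tt) (λ _ → j , o , refl , refl)
    λ i i′ (_ , _ , eq) (_ , _ , eq′) → Finₚ.toℕ-injective (trans eq (sym eq′)))

gf-endsIn : ∀ {p} {P : Pred Word p} (P? : Decidable P) v → IsComposition v →
  gf (λ τ → [ endsIn? P? v τ ]) ≈ gf (λ σ → [ P? σ ]) * monomial (weight v) (length v)
gf-endsIn P? v v-comp = begin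
  gf (λ τ → [ endsIn? P? v τ ])                        ≈⟨ gf-cong (⋆-δ P? v) ⟨
  gf ((λ σ → [ P? σ ]) ⋆ δ v)                          ≈⟨ gf-⋆ _ (δ v) ⟩
  gf (λ σ → [ P? σ ]) * gf (δ v)                       ≈⟨ SeriesRing.*-congˡ {gf (λ σ → [ P? σ ])} (gf-δ v v-comp) ⟩
  gf (λ σ → [ P? σ ]) * monomial (weight v) (length v) ∎
  where open SetoidReasoning SeriesRing.setoid

-- Each overlap contributes the words of `P` extended by its overhang, and the monomial of the
-- overhang is the matching term of the correlation polynomial.
gf-overlaps : ∀ {p} {P : Pred Word p} (P? : Decidable P) X Y → IsComposition X →
  gf (λ τ → sum (λ j → [ overlap? X Y j ×-dec endsIn? P? (overhang X j) τ ])) ≈ gf (λ σ → [ P? σ ]) * correlation X Y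
gf-overlaps P? X Y X-comp = begin
  gf (λ τ → sum (λ j → [ Q? j τ ]))   ≈⟨ gf-sum (λ j τ → [ Q? j τ ]) ⟩
  ∑ (λ j → gf (λ τ → [ Q? j τ ]))     ≈⟨ ∑-cong term ⟩
  ∑ (λ j → B * correlation-term X Y j) ≈⟨ *-distribˡ-∑ B (correlation-term X Y) ⟨
  B * correlation X Y                 ∎
  where
  open SetoidReasoning SeriesRing.setoid
  B = gf (λ σ → [ P? σ ])
  Q? : ∀ j τ → Dec (Overlap X Y j × EndsIn _ (overhang X j) τ)
  Q? j τ = overlap? X Y j ×-dec endsIn? P? (overhang X j) τ
  term : ∀ j → gf (λ τ → [ Q? j τ ]) ≈ B * correlation-term X Y j
  term j with does (overlap? X Y j)
  ... | true  = subst (λ n → gf (λ τ → [ endsIn? P? (overhang X j) τ ]) ≈ B * monomial (weight (overhang X j)) n)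
                      (length-overhang X j)
                      (gf-endsIn P? (overhang X j) (Allₚ.drop⁺ (length X ∸ toℕ j) X-comp))
  ... | false = λ a b → trans (sumOver-zero (compositions a b)) (sym (SeriesRing.zeroʳ B a b))

-- First occurrences of listed words

module _ {k} (S : Fin k → Word) where

  -- Avoidance passes to prefixes, so removing just the last letter covers all proper prefixes. For
  -- the empty word the condition is vacuous.
  ProperlyAvoids : Pred Word _
  ProperlyAvoids ρ = ∀ {σ a} → ρ ≡ σ ∷ʳ a → Avoids S σ

  properlyAvoids? : Decidable ProperlyAvoids
  properlyAvoids? ρ with initLast ρ
  ... | []      = yes λ {σ} {a} eq → contradiction eq (∷ʳ-nonempty σ a)
  ... | σ ∷ʳ′ a = map′ (λ avoids {σ′} eq → subst (Avoids S) (Listₚ.∷ʳ-injectiveˡ σ σ′ eq) avoids) (λ f → f refl) (avoids? S σ)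

  -- The first occurrence of a word of the list in ρ is S j, at the end of ρ.
  First : Fin k → Pred Word _
  First j ρ = S j ⊒ ρ × ProperlyAvoids ρ

  first? : ∀ j → Decidable (First j)
  first? j ρ = (S j ⊒? ρ) ×-dec properlyAvoids? ρ

  avoids-prefix : ∀ {σ v} → Avoids S (σ ++ v) → Avoids S σ
  avoids-prefix {v = v} avoids j = avoids j ∘ ⊑-++ʳ v

  properlyAvoids-prefix : ∀ {σ v} → v ≢ [] → ProperlyAvoids (σ ++ v) → Avoids S σ
  properlyAvoids-prefix {σ} {v} v≢[] proper with initLast v
  ... | []      = contradiction refl v≢[]
  ... | u ∷ʳ′ a = avoids-prefix {v = u} (proper (sym (Listₚ.++-assoc σ u (a ∷ []))))

  -- An occurrence that stops before the last letter would already lie in `σ`.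
  first-intro : ∀ {σ a} → Avoids S σ → ¬ Avoids S (σ ∷ʳ a) → ∃ λ j → First j (σ ∷ʳ a)
  first-intro {σ} {a} avoids ¬avoids
    with j , ¬¬S⊑ ← Finₚ.¬∀⟶∃¬ k (λ j → ¬ (S j ⊑ σ ∷ʳ a)) (λ j → ¬? (S j ⊑? σ ∷ʳ a)) ¬avoids
    with u , v , eq ← ⊑⁻ (decidable-stable (S j ⊑? σ ∷ʳ a) ¬¬S⊑)
    with initLast v
  ... | [] = j , subst (S j ⊒_) (sym (trans eq (cong (u ++_) (Listₚ.++-identityʳ (S j))))) (⊒⁺ u (S j))
               , λ {σ′} eq′ → subst (Avoids S) (Listₚ.∷ʳ-injectiveˡ σ σ′ eq′) avoids
  ... | w ∷ʳ′ b = contradiction (subst (S j ⊑_) (sym σ≡) (⊑⁺ u (S j) w)) (avoids j)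
    where
    σ≡ : σ ≡ u ++ S j ++ w
    σ≡ = Listₚ.∷ʳ-injectiveˡ σ (u ++ S j ++ w)
      (trans eq (sym (trans (Listₚ.++-assoc u (S j ++ w) _) (cong (u ++_) (Listₚ.++-assoc (S j) w _)))))

  -- Append the letters of `w` to `σ` one at a time and stop at the first one that destroys
  -- avoidance.
  first-occurrence : ∀ σ w → Avoids S σ → ¬ Avoids S (σ ++ w) →
    ∃ λ i → ∃₂ λ a u → ∃ λ v → w ≡ a ∷ u ++ v × First i (σ ++ a ∷ u)
  first-occurrence σ []      avoids ¬avoids = contradiction (subst (Avoids S) (sym (Listₚ.++-identityʳ σ)) avoids) ¬avoids
  first-occurrence σ (a ∷ w) avoids ¬avoids with avoids? S (σ ∷ʳ a)
  ... | no ¬avoids′ with i , first ← first-intro avoids ¬avoids′ = i , a , [] , w , refl , first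
  ... | yes avoids′
    with i , b , u , v , refl , first ←
           first-occurrence (σ ∷ʳ a) w avoids′ (subst (¬_ ∘ Avoids S) (sym (Listₚ.∷ʳ-++ σ a w)) ¬avoids)
    = i , a , b ∷ u , v , refl , subst (First i) (Listₚ.∷ʳ-++ σ a (b ∷ u)) first

  S⋢[] : (∀ i → S i ≢ []) → ∀ j → ¬ (S j ⊑ [])
  S⋢[] S≢[] j Sj⊑[] with u , v , eq ← ⊑⁻ Sj⊑[] = S≢[] j (Listₚ.++-conicalˡ (S j) v (Listₚ.++-conicalʳ u _ (sym eq)))

  module _ (incomparable : ∀ i j → i ≢ j → ¬ (S i ⊑ S j)) where

    -- Of two words ending at the same place, one is a suffix of the other.
    first-unique : ∀ {ρ} i j → First i ρ → First j ρ → i ≡ j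
    first-unique {ρ} i j (Si⊒ρ , _) (Sj⊒ρ , _) with i Finₚ.≟ j
    ... | yes i≡j = i≡j
    ... | no i≢j with u , refl ← ⊒⁻ Si⊒ρ | v , eq ← ⊒⁻ Sj⊒ρ with ++-≡-++ u (S i) v (S j) eq
    ...   | inj₁ (e , _ , Sj≡)     = contradiction (⊒⇒⊑ (subst (S i ⊒_) (sym Sj≡) (⊒⁺ e (S i)))) (incomparable i j i≢j)
    ...   | inj₂ (a , e , _ , Si≡) = contradiction (⊒⇒⊑ (subst (S j ⊒_) (sym Si≡) (⊒⁺ (a ∷ e) (S j)))) (incomparable j i (i≢j ∘ sym))

    -- For different indices this is incomparability, for equal ones a comparison of lengths. It
    -- excludes a first occurrence that starts later than an appended `S j`.
    no-proper-factor : ∀ i j b e v → S j ≢ b ∷ e ++ S i ++ v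
    no-proper-factor i j b e v Sj≡ with i Finₚ.≟ j
    ... | no i≢j   = incomparable i j i≢j (subst (S i ⊑_) (sym Sj≡) (⊑⁺ (b ∷ e) (S i) v))
    ... | yes refl = ℕₚ.<-irrefl (cong length Sj≡)
      (s≤s (ℕₚ.≤-trans (Listₚ.length-++-≤ˡ (S i)) (Listₚ.length-++-≤ʳ (S i ++ v) {e})))

    -- If `σ` avoids the list, then `σ ∷ʳ a` either still does or ends in a first occurrence, whose
    -- index is determined by `first-unique`.
    append-letter : ∀ σ a → [ avoids? S σ ] ≡ [ avoids? S (σ ∷ʳ a) ] ℤ.+ sum (λ j → [ first? j (σ ∷ʳ a) ])
    append-letter σ a = trans ([]-split (avoids? S σ) (avoids? S (σ ∷ʳ a)) avoids-prefix)
      (cong (λ u → [ avoids? S (σ ∷ʳ a) ] ℤ.+ u) (sym (sum-indicator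
        (λ j → first? j (σ ∷ʳ a)) (avoids? S σ ×-dec ¬? (avoids? S (σ ∷ʳ a)))
        (λ { j (Sj⊒ , proper) → proper refl , λ avoids → avoids j (⊒⇒⊑ Sj⊒) })
        (λ { (avoids , ¬avoids) → first-intro avoids ¬avoids })
        first-unique)))
      where
      []-split : ∀ {P R : Set} (P? : Dec P) (R? : Dec R) → (R → P) → [ P? ] ≡ [ R? ] ℤ.+ [ P? ×-dec ¬? R? ]
      []-split (yes _) (yes _) _ = refl
      []-split (yes _) (no _)  _ = refl
      []-split (no ¬p) (yes r) f = contradiction (f r) ¬p
      []-split (no _)  (no _)  _ = refl

    -- The first equation between formal sums, read off at `τ`. A nonempty word is split before its
    -- last letter; the empty word, which avoids all nonempty words, is supplied by `δ []`.
    append-letters : (∀ i → S i ≢ []) → ∀ τ →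
      δ [] τ ℤ.+ ((λ σ → [ avoids? S σ ]) ⋆ letter) τ ≡ [ avoids? S τ ] ℤ.+ sum (λ j → [ first? j τ ])
    append-letters S≢[] τ = by-last-letter (initLast τ)
      where
      by-last-letter : ∀ {τ} → InitLast τ →
        δ [] τ ℤ.+ ((λ σ → [ avoids? S σ ]) ⋆ letter) τ ≡ [ avoids? S τ ] ℤ.+ sum (λ j → [ first? j τ ])
      by-last-letter []        =
        trans (cong (λ u → 1ℤ ℤ.+ u) (ℤₚ.*-zeroʳ [ avoids? S [] ]))
              (sym (cong₂ ℤ._+_ ([]-true (avoids? S []) (S⋢[] S≢[]))
                                (sum-zero λ j → []-false (first? j []) (S⋢[] S≢[] j ∘ ⊒⇒⊑ ∘ proj₁))))
      by-last-letter (σ ∷ʳ′ a) =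
        trans (cong₂ ℤ._+_ ([]-false ([] ≟ σ ∷ʳ a) (∷ʳ-nonempty σ a)) (⋆-letter _ σ a))
              (trans (ℤₚ.+-identityˡ _) (append-letter σ a))

    module _ (uncorrelated : ∀ i j → i ≢ j → correlation (S i) (S j) ≈ 0#) where

      -- The second equation, read off at `τ`: cut σ S_j right after its first occurrence of a
      -- listed word. What remains of S_j is the overhang of an overlap of S_j with itself.
      append-word : ∀ j τ → [ endsIn? (avoids? S) (S j) τ ] ≡
        sum (λ t → [ overlap? (S j) (S j) t ×-dec endsIn? (first? j) (overhang (S j) t) τ ])
      append-word j τ = sym (sum-indicator P? (endsIn? (avoids? S) (S j) τ) sound complete unique)
        where
        P : Fin (length (S j)) → Set
        P t = Overlap (S j) (S j) t × EndsIn (First j) (overhang (S j) t) τ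

        P? : ∀ t → Dec (P t)
        P? t = overlap? (S j) (S j) t ×-dec endsIn? (first? j) (overhang (S j) t) τ

        -- With ρ = p S_j and S_j = r u for the overlapping prefix u, the word τ is (p r) S_j. Since
        -- u is nonempty, p r is a proper prefix of ρ and hence avoids the list.
        sound : ∀ t → P t → EndsIn (Avoids S) (S j) τ
        sound t (o , ρ , τ≡ , Sj⊒ρ , proper)
          with p , refl ← ⊒⁻ Sj⊒ρ | r , Sj≡ ← ⊒⁻ o =
          p ++ r , τ≡′ , properlyAvoids-prefix (take-nonempty (S j) t) (subst ProperlyAvoids ρ≡ proper)
          where
          open ≡-Reasoning
          u = take (length (S j) ∸ toℕ t) (S j)
          v = overhang (S j) t
          ρ≡ : p ++ S j ≡ (p ++ r) ++ u
          ρ≡ = trans (cong (p ++_) Sj≡) (sym (Listₚ.++-assoc p r u))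
          τ≡′ : τ ≡ (p ++ r) ++ S j
          τ≡′ = begin
            τ                    ≡⟨ τ≡ ⟩
            (p ++ S j) ++ v      ≡⟨ cong (_++ v) ρ≡ ⟩
            ((p ++ r) ++ u) ++ v ≡⟨ Listₚ.++-assoc (p ++ r) u v ⟩
            (p ++ r) ++ u ++ v   ≡⟨ cong ((p ++ r) ++_) (Listₚ.take++drop≡id (length (S j) ∸ toℕ t) (S j)) ⟩
            (p ++ r) ++ S j      ∎

        -- A proper extension of `ρ′` contains the final `S j` of `ρ′` before its own last letter.
        first-end : ∀ {ρ ρ′} a e → First j ρ → First j ρ′ → ρ ≢ ρ′ ++ a ∷ e
        first-end a e (_ , proper) (Sj⊒ρ′ , _) refl = properlyAvoids-prefix (λ ()) proper j (⊒⇒⊑ Sj⊒ρ′)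

        unique : ∀ t t′ → P t → P t′ → t ≡ t′
        unique t t′ (_ , ρ , τ≡ , first) (_ , ρ′ , τ≡′ , first′)
          with ++-≡-++ ρ (overhang (S j) t) ρ′ (overhang (S j) t′) (trans (sym τ≡) τ≡′)
        -- When neither cut comes later, the overhangs coincide, and their length is the shift.
        ... | inj₁ ([] , _ , v≡)       = Finₚ.toℕ-injective
          (trans (sym (length-overhang (S j) t)) (trans (cong length (sym v≡)) (length-overhang (S j) t′)))
        ... | inj₁ (a ∷ e , ρ≡ , _)    = contradiction ρ≡ (first-end a e first first′)
        ... | inj₂ (a , e , ρ′≡ , _)   = contradiction ρ′≡ (first-end a e first′ first)

        complete : EndsIn (Avoids S) (S j) τ → ∃ P
        complete (σ , refl , avoids)
          with i , a , u , v , Sj≡ , first@(Si⊒ , _) ←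
                 first-occurrence σ (S j) avoids (λ avoids′ → avoids′ j (⊒⇒⊑ (⊒⁺ σ (S j))))
          with p , eq ← ⊒⁻ Si⊒
          with ++-≡-++ σ (a ∷ u) p (S i) eq
        -- Here `S i` starts later than the appended `S j` and lies inside it.
        ... | inj₂ (b , e , _ , u≡) =
          contradiction (trans Sj≡ (trans (cong (_++ v) u≡) (Listₚ.++-assoc (b ∷ e) (S i) v))) (no-proper-factor i j b e v)
        -- Here the prefix `a ∷ u` of `S j` is a suffix of `S i`. The vanishing of the mixed
        -- correlations allows this only for i = j.
        ... | inj₁ (e , _ , Si≡)
          with t , o , overhang≡ ← overlap⁺ a u v Sj≡ (subst (a ∷ u ⊒_) (sym Si≡) (⊒⁺ e (a ∷ u)))
          with i Finₚ.≟ j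
        ...   | no i≢j   = contradiction o (correlation-zero (S j) (S i) (uncorrelated j i (i≢j ∘ sym)) t)
        ...   | yes refl = t , o , σ ++ a ∷ u , σSj≡ , first
          where
          σSj≡ : σ ++ S j ≡ (σ ++ a ∷ u) ++ overhang (S j) t
          σSj≡ = trans (cong (σ ++_) (trans Sj≡ (cong ((a ∷ u) ++_) (sym overhang≡)))) (sym (Listₚ.++-assoc σ (a ∷ u) _))

-- Elimination of the series B_j

theorem2 : ∀ (k : ℕ) (S : Fin k → Word) →
    (∀ i → IsComposition (S i)) →
    (∀ i → S i ≢ []) →
    (∀ i j → i ≢ j → ¬ (S i ⊑ S j)) →
    (∀ i j → i ≢ j → correlation (S i) (S j) ≈ 0#) →
    avoidanceSeries S ≈ 1# / (1# - q * x / (1# - x) + ∑ (λ j → monomial (weight (S j)) (length (S j)) / correlation (S j) (S j)))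
theorem2 k S S-comp S≢[] incomparable uncorrelated =
  SeriesRing.sym {1# / D} {avoidanceSeries S} (SeriesRing.trans {1# / D} {F} {avoidanceSeries S}
    (/-unique 1# D F (denominator-constant S S≢[]) F*D≈1)
    (λ n m → sym (sumOver-filter (avoids? S) (compositions n m))))
  where
  open SetoidReasoning SeriesRing.setoid

  F G D : Series
  F = gf (λ σ → [ avoids? S σ ])
  G = q * x / (1# - x)

  M c B : Fin k → Series
  M j = monomial (weight (S j)) (length (S j))
  c j = correlation (S j) (S j)
  B j = gf (λ σ → [ first? S j σ ])

  D = 1# - G + ∑ (λ j → M j / c j)

  letters : 1# + F * G ≈ F + ∑ B
  letters = begin
    1# + F * G
      ≈⟨ SeriesRing.+-cong {1#} {gf (δ [])} (SeriesRing.sym {gf (δ [])} (gf-δ [] [])) (SeriesRing.*-congˡ {F} gf-letter) ⟩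
    gf (δ []) + F * gf letter
      ≈⟨ SeriesRing.+-congˡ {gf (δ [])} (gf-⋆ (λ σ → [ avoids? S σ ]) letter) ⟨
    gf (δ []) + gf ((λ σ → [ avoids? S σ ]) ⋆ letter)
      ≈⟨ gf-+ (δ []) _ ⟨
    gf (λ τ → δ [] τ ℤ.+ ((λ σ → [ avoids? S σ ]) ⋆ letter) τ)
      ≈⟨ gf-cong (append-letters S incomparable S≢[]) ⟩
    gf (λ τ → [ avoids? S τ ] ℤ.+ sum (λ j → [ first? S j τ ]))
      ≈⟨ gf-+ _ _ ⟩
    F + gf (λ τ → sum (λ j → [ first? S j τ ]))
      ≈⟨ SeriesRing.+-congˡ {F} (gf-sum (λ j τ → [ first? S j τ ])) ⟩
    F + ∑ B ∎

  -- The second equation divided by `c j`, whose constant term is 1.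
  words : ∀ j → F * (M j / c j) ≈ B j
  words j = begin
    F * (M j / c j) ≈⟨ *-/-assoc F (M j) (c j) ⟩
    F * M j / c j   ≈⟨ /-unique (F * M j) (c j) (B j) (correlation-constant (S j) (S≢[] j)) B*c≈F*M ⟩
    B j             ∎
    where
    B*c≈F*M : B j * c j ≈ F * M j
    B*c≈F*M = begin
      B j * c j
        ≈⟨ gf-overlaps (first? S j) (S j) (S j) (S-comp j) ⟨
      gf (λ τ → sum (λ t → [ overlap? (S j) (S j) t ×-dec endsIn? (first? S j) (overhang (S j) t) τ ]))
        ≈⟨ gf-cong (append-word S incomparable uncorrelated j) ⟨
      gf (λ τ → [ endsIn? (avoids? S) (S j) τ ])
        ≈⟨ gf-endsIn (avoids? S) (S j) (S-comp j) ⟩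
      F * M j ∎

  F*D≈1 : F * D ≈ 1#
  F*D≈1 = begin
    F * D
      ≈⟨ SeriesRing.distribˡ F (1# - G) (∑ (λ j → M j / c j)) ⟩
    F * (1# - G) + F * ∑ (λ j → M j / c j)
      ≈⟨ SeriesRing.+-cong {F * (1# - G)} {F * 1# - F * G} (*-distribˡ-- F 1# G) (*-distribˡ-∑ F (λ j → M j / c j)) ⟩
    F * 1# - F * G + ∑ (λ j → F * (M j / c j))
      ≈⟨ (λ a b → cong₂ (λ u v → u ℤ.- (F * G) a b ℤ.+ v) (SeriesRing.*-identityʳ F a b) (∑-cong words a b)) ⟩
    F - F * G + ∑ B
      -- By `letters`, F + ∑ B is 1 + F G, so the terms F G cancel.
      ≈⟨ (λ a b → rearrange (F a b) ((F * G) a b) (∑ B a b) (1# a b) (letters a b)) ⟩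
    1# ∎
    where
    rearrange : ∀ f g b u → u ℤ.+ g ≡ f ℤ.+ b → f ℤ.- g ℤ.+ b ≡ u
    rearrange f g b u eq = trans (xy∙z≈xz∙y f (ℤ.- g) b)
      (trans (cong (ℤ._- g) (sym eq)) (trans (ℤₚ.+-assoc u g (ℤ.- g))
        (trans (cong (λ v → u ℤ.+ v) (ℤₚ.+-inverseʳ g)) (ℤₚ.+-identityʳ u))))
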